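{- Let $B$ be a finite set of vincular patterns, let $p\in S_k$ be a prefix pattern and let $\vec v\in\mathbb{N}^{k+1}$. Suppose every permutation $\pi\in A(p,\vec v)$ contains a copy of some $(\sigma,X)\in B$ such that all positions of the head of that copy lie in $\{1,\dots,k\}$ (i.e. the letters of the copy corresponding to the head of $(\sigma,X)$ are among $\pi_1\cdots\pi_k$). Then $\vec v$ is a gap vector for $p$ with respect to $B$.
   Context: For a word $w$ of distinct integers, $\mathrm{red}(w)$ replaces the $i$-th smallest letter by $i$; $u\sim w$ means $\mathrm{red}(u)=\mathrm{red}(w)$. A vincular pattern of length $\ell$ is a pair $(\sigma,X)$ with $\sigma\in S_\ell$ and $X\subseteq[\ell-1]$. A permutation $\pi\in S_n$ contains $(\sigma,X)$ if there are indices $i_1<\dots<i_\ell$ with $\mathrm{red}(\pi_{i_1}\cdots\pi_{i_\ell})=\sigma$ and $i_{x+1}=i_x+1$ for every $x\in X$; the subsequence $\pi_{i_1}\cdots\pi_{i_\ell}$ is a copy. $\pi$ avoids a set $B$ of such patterns if it contains none of them. The head of $(\sigma,X)$ is the pattern formed by its first $m+1$ letters, $(\mathrm{red}(\sigma_1\cdots\sigma_{m+1}),X)$, where $m=\max X$ ($m=0$ if $X=\emptyset$). For a word $w\in[n]^k$ with distinct letters, let $c_i$ be its $i$-th smallest letter, $c_0=0$, $c_{k+1}=n+1$; the spacing vector $\vec g(n,w)\in\mathbb{N}^{k+1}$ has $i$-th component $c_i-c_{i-1}-1$. For $p\in S_k$ and such $w$ with $\mathrm{red}(w)=p$, let $S_n^B(p;w)$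 be the set of $B$-avoiding $\pi\in S_n$ with $\pi_i=w_i$ for $1\le i\le k$. A vector $\vec v\in\mathbb{N}^{k+1}$ is a gap vector for $p$ with respect to $B$ if for every $n$ and every such $w$ with $\vec g(n,w)\ge\vec v$ (componentwise), $S_n^B(p;w)=\emptyset$. Finally, $A(p,\vec v)$ is the set of permutations $\pi\in S_{k+|\vec v|}$ (where $|\vec v|$ is the sum of the components) with $\pi_1\cdots\pi_k\sim p$ and $\vec g(k+|\vec v|,\pi_1\cdots\pi_k)=\vec v$. -}

module Defs where

open import Data.Fin.Base as Fin using (Fin; suc; inject₁; toℕ)
open import Data.Fin.Permutation using (Permutation′; _⟨$⟩ʳ_)
open import Data.Fin.Subset using (Subset; _∈_)
open import Data.Fin.Subset.Properties using (_∈?_)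
open import Data.List.Base as List using (List; allFin; filter)
open import Data.List.Extrema.Nat using (max)
import Data.List.Membership.Propositional as List
open import Data.List.Relation.Binary.Permutation.Propositional.Properties using (↭-length)
open import Data.Nat.Base using (ℕ; suc; _+_; _∸_; _≤_; _<_)
open import Data.Nat.Properties using (_≤?_; ≤-decTotalOrder)
open import Data.List.Sort.InsertionSort.Base ≤-decTotalOrder using (sort)
open import Data.List.Sort.InsertionSort.Properties ≤-decTotalOrder using (sort-↭)
open import Data.Product.Base using (Σ-syntax; _×_)
open import Data.Vec.Base using (Vec; _∷_; _∷ʳ_; cast; count; fromList; lookup; map; sum; tabulate; take; toList; zipWith)
open import Data.Vec.Properties using (length-toList)
open import Data.Vec.Relation.Binary.Pointwise.Inductive using (Pointwise)
open import Data.Vec.Relation.Unary.All using (All)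
open import Data.Vec.Relation.Unary.Unique.Propositional using (Unique)
open import Function.Base using (_∘_)
open import Relation.Binary.PropositionalEquality using (_≡_; trans)
open import Relation.Nullary using (¬_)

private
  variable
    k n : ℕ

-- Letters are the usual 1-based ones; positions are 0-based (elements of Fin).

letter : Permutation′ n → Fin n → ℕ
letter π i = suc (toℕ (π ⟨$⟩ʳ i))

word : Permutation′ n → Vec ℕ n
word π = tabulate (letter π)

-- A letter of a word with distinct letters is the i-th smallest exactly when
-- i letters of the word are ≤ it.
red : Vec ℕ k → Vec ℕ k
red w = map (λ a → count (_≤? a) w) w

infix 4 _∼_

_∼_ : Vec ℕ k → Vec ℕ k → Set
u ∼ w = red u ≡ red w

record IsDistinctWord (n : ℕ) (w : Vec ℕ k) : Set where
  field
    inRange  : All (λ a → 1 ≤ a × a ≤ n) w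
    distinct : Unique w

-- The letters c₁ < … < c_k of w in increasing order.
sorted : Vec ℕ k → Vec ℕ k
sorted w = cast (trans (↭-length (sort-↭ (toList w))) (length-toList w)) (fromList (sort (toList w)))

-- (c₁ ∸ c₀ ∸ 1 , … , c_{k+1} ∸ c_k ∸ 1) with c₀ = 0 and c_{k+1} = n + 1.  The
-- truncated subtractions are exact on words satisfying IsDistinctWord n.
spacing : ℕ → Vec ℕ k → Vec ℕ (suc k)
spacing n w = zipWith (λ c c⁺ → c⁺ ∸ c ∸ 1) (0 ∷ sorted w) (sorted w ∷ʳ suc n)

-- The length ℓ = suc ℓ-1 is positive, since a head has at least one letter.
-- The element x : Fin ℓ-1 of X stands for the number toℕ x + 1 in [ℓ - 1]; it
-- forces the letters at the 0-based indices inject₁ x and suc x to be adjacent.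
record VincularPattern : Set where
  constructor vincular
  field
    {ℓ-1} : ℕ
    σ     : Permutation′ (suc ℓ-1)
    X     : Subset ℓ-1

  ℓ : ℕ
  ℓ = suc ℓ-1

  -- m = max X, and m = 0 if X is empty.
  m : ℕ
  m = max 0 (List.map (suc ∘ toℕ) (filter (_∈? X) (allFin ℓ-1)))

  -- The head consists of the first m + 1 letters of σ.
  headLength : ℕ
  headLength = suc m

record Copy (P : VincularPattern) (π : Permutation′ n) : Set where
  open VincularPattern P
  field
    position   : Fin ℓ → Fin n
    increasing : ∀ {a b} → a Fin.< b → position a Fin.< position b
    reduces    : red (tabulate (letter π ∘ position)) ≡ word σ
    adjacent   : ∀ {x} → x ∈ X → toℕ (position (suc x)) ≡ suc (toℕ (position (inject₁ x)))

-- All positions of the head of the copy are among the first k positions.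
HeadWithin : ∀ {P} {π : Permutation′ n} → ℕ → Copy P π → Set
HeadWithin {P = P} k c = ∀ a → toℕ a < VincularPattern.headLength P → toℕ (Copy.position c a) < k

Contains : Permutation′ n → VincularPattern → Set
Contains π P = Copy P π

Avoids : Permutation′ n → List VincularPattern → Set
Avoids π B = ∀ {P} → P List.∈ B → ¬ Contains π P

-- π_i = w_i for 1 ≤ i ≤ k; in particular π has at least k letters.
HasPrefix : Permutation′ n → Vec ℕ k → Set
HasPrefix {n = n} {k = k} π w = ∀ (i : Fin k) → Σ[ j ∈ Fin n ] (toℕ j ≡ toℕ i × letter π j ≡ lookup w i)

-- Membership in S_n^B(p; w), where p = red w is determined by w.
record InS (B : List VincularPattern) (w : Vec ℕ k) (π : Permutation′ n) : Set where
  field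
    avoids : Avoids π B
    prefix : HasPrefix π w

IsGapVector : List VincularPattern → Permutation′ k → Vec ℕ (suc k) → Set
IsGapVector {k = k} B p v =
  ∀ (n : ℕ) (w : Vec ℕ k) → IsDistinctWord n w → red w ≡ word p →
  Pointwise _≤_ v (spacing n w) →
  ∀ (π : Permutation′ n) → ¬ InS B w π

-- Membership in A(p, v).
record InA (p : Permutation′ k) (v : Vec ℕ (suc k)) (π : Permutation′ (k + sum v)) : Set where
  field
    prefix∼  : take k (word π) ∼ word p
    spacing≡ : spacing (k + sum v) (take k (word π)) ≡ v

{-# OPTIONS --safe #-}

-- Delete letters one at a time.  If the gaps of the prefix of π exceed v in
-- total, some letter t lies in a gap that is larger than v demands; t is not a
-- prefix letter, so it stands after position k, and deleting it keeps the
-- pattern of the prefix and the inequality with v.  When nothing is left to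
-- delete, the permutation lies in A(p, v) and has a copy whose head is within
-- the first k positions.  Such a copy survives the reinsertion of a letter
-- after position k, because all its adjacency conditions concern the head.
module Submission where

open import Defs
open import Data.Bool.Base using (true; false)
open import Data.Fin.Base using (Fin; zero; suc; toℕ; fromℕ<; inject₁; inject≤; punchIn; punchOut)
open import Data.Fin.Permutation using (Permutation′; _⟨$⟩ʳ_; _⟨$⟩ˡ_; inverseʳ; punchIn-permute; remove)
open import Data.Fin.Properties using (punchIn-punchOut; toℕ-fromℕ<; toℕ-inject₁; toℕ-inject≤; toℕ-injective; toℕ<n)
import Data.Fin.Subset as Subset
open import Data.Fin.Subset.Properties using (_∈?_)
open import Data.List.Base as List using (List)
open import Data.List.Extrema.Nat using (xs≤max)
open import Data.List.Membership.Propositional using (_∈_)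
open import Data.List.Membership.Propositional.Properties using (∈-allFin; ∈-filter⁺; ∈-map⁺)
open import Data.List.Relation.Binary.Permutation.Propositional using (↭-sym; ↭⇒↭ₛ)
open import Data.List.Relation.Binary.Permutation.Propositional.Properties using (All-resp-↭; ∈-resp-↭)
import Data.List.Relation.Binary.Permutation.Setoid.Properties as Permutationₛ
open import Data.List.Relation.Unary.All as ListAll using ([]; _∷_)
open import Data.List.Relation.Unary.AllPairs as AllPairs using (AllPairs; []; _∷_)
open import Data.List.Relation.Unary.Sorted.TotalOrder.Properties using (Sorted⇒AllPairs)
open import Data.Nat.Base using (ℕ; zero; suc; _+_; _∸_; _≤_; _<_; z≤n; s≤s; s≤s⁻¹)
open import Data.Nat.Properties
open import Data.List.Sort.InsertionSort.Base ≤-decTotalOrder using (insert; sort)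
open import Data.List.Sort.InsertionSort.Properties ≤-decTotalOrder using (sort-↭; sort-↗)
open import Data.Nat.Tactic.RingSolver using (solve-∀)
open import Data.Product.Base using (Σ-syntax; ∃-syntax; _×_; _,_; proj₁; proj₂)
open import Data.Sum.Base using (inj₁; inj₂)
open import Data.Vec.Base using (Vec; []; _∷_; _∷ʳ_; count; fromList; lookup; map; sum; tabulate; take; toList; zipWith)
import Data.Vec.Membership.Propositional as Vec
open import Data.Vec.Membership.Propositional.Properties using (∈-lookup; ∈-toList⁺; ∈-toList⁻)
open import Data.Vec.Properties using (cast-is-id; lookup∘tabulate; lookup-map; lookup-take-inject≤; map-∘; tabulate-∘; tabulate-cong; tabulate∘lookup; toList-cast; toList-injective; toList-map; toList∘fromList)
open import Data.Vec.Relation.Binary.Pointwise.Inductive using (Pointwise; []; _∷_)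
import Data.Vec.Relation.Unary.All as All
open import Data.Vec.Relation.Unary.Any using (here; there)
open import Data.Vec.Relation.Unary.Unique.Propositional using (Unique; []; _∷_)
open import Function.Base using (_∘_)
open import Function.Bundles using (_⇔_; mk⇔; Equivalence)
open import Level using (Level)
open import Relation.Binary.Definitions using (tri<; tri≈; tri>)
open import Relation.Binary.PropositionalEquality
open import Relation.Nullary using (¬_; yes; no; does; contradiction)
open import Relation.Nullary.Decidable using (does-⇔)
open import Relation.Unary using (Pred; Decidable; _⊆_)

private
  variable
    ℓ : Level
    A C : Set
    k n t a b : ℕ

-- Reduction

map-cong-∈ : {f g : A → C} (xs : Vec A k) → (∀ {x} → x Vec.∈ xs → f x ≡ g x) → map f xs ≡ map g xs
map-cong-∈ []       f≗g = refl
map-cong-∈ (x ∷ xs) f≗g = cong₂ _∷_ (f≗g (here refl)) (map-cong-∈ xs (f≗g ∘ there))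

module _ {P : Pred A ℓ} {Q : Pred C ℓ} (P? : Decidable P) (Q? : Decidable Q) where

  count-map : ∀ {f} (xs : Vec C k) → (∀ {x} → x Vec.∈ xs → P (f x) ⇔ Q x) →
              count P? (map f xs) ≡ count Q? xs
  count-map         []       P⇔Q = refl
  count-map {f = f} (x ∷ xs) P⇔Q
    rewrite does-⇔ (P⇔Q (here refl)) (P? (f x)) (Q? x)
          | count-map {f = f} xs (P⇔Q ∘ there) = refl

module _ {P Q : Pred A ℓ} (P? : Decidable P) (Q? : Decidable Q) where

  count-mono : P ⊆ Q → (xs : Vec A k) → count P? xs ≤ count Q? xs
  count-mono P⊆Q []       = z≤n
  count-mono P⊆Q (x ∷ xs) with P? x | Q? x
  ... | yes _  | yes _  = s≤s (count-mono P⊆Q xs)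
  ... | yes px | no ¬qx = contradiction (P⊆Q px) ¬qx
  ... | no _   | yes _  = m≤n⇒m≤1+n (count-mono P⊆Q xs)
  ... | no _   | no _   = count-mono P⊆Q xs

  count-strictMono : P ⊆ Q → ∀ {x} {xs : Vec A k} → x Vec.∈ xs → Q x → ¬ P x →
                     count P? xs < count Q? xs
  count-strictMono P⊆Q {x} {xs = _ ∷ xs} (here refl) qx ¬px with P? x | Q? x
  ... | yes px | _      = contradiction px ¬px
  ... | no _   | no ¬qx = contradiction qx ¬qx
  ... | no _   | yes _  = s≤s (count-mono P⊆Q xs)
  count-strictMono P⊆Q {xs = y ∷ _} (there x∈xs) qx ¬px with P? y | Q? y
  ... | yes _  | yes _  = s≤s (count-strictMono P⊆Q x∈xs qx ¬px)
  ... | yes py | no ¬qy = contradiction (P⊆Q py) ¬qy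
  ... | no _   | yes _  = m≤n⇒m≤1+n (count-strictMono P⊆Q x∈xs qx ¬px)
  ... | no _   | no _   = count-strictMono P⊆Q x∈xs qx ¬px

-- Each entry of `red` counts comparisons among entries of `w`, so only the order on those entries
-- matters. `red-idem` applies this to a map that need not reflect `≤` elsewhere.
red-map : ∀ f (w : Vec ℕ k) → (∀ {x y} → x Vec.∈ w → y Vec.∈ w → f x ≤ f y ⇔ x ≤ y) →
          red (map f w) ≡ red w
red-map f w f-≤ = trans
  (sym (map-∘ _ f w))
  (map-cong-∈ w (λ y∈w → count-map (_≤? _) (_≤? _) w (λ x∈w → f-≤ x∈w y∈w)))

-- Ranking preserves order, and reflects it on `w`: if `y < x`, then `x` itself counts towards the
-- rank of `x` but not of `y`. This reconciles `red w ≡ word p` in `IsGapVector` with `∼` in `InA`.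
red-idem : (w : Vec ℕ k) → red (red w) ≡ red w
red-idem w = red-map rank w (λ x∈w _ → mk⇔ (rank-cancel-≤ x∈w) rank-mono)
  where
  rank : ℕ → ℕ
  rank y = count (_≤? y) w

  rank-mono : ∀ {x y} → x ≤ y → rank x ≤ rank y
  rank-mono {x} {y} x≤y = count-mono (_≤? x) (_≤? y) (λ z≤x → ≤-trans z≤x x≤y) w

  rank-cancel-≤ : ∀ {x y} → x Vec.∈ w → rank x ≤ rank y → x ≤ y
  rank-cancel-≤ {x} {y} x∈w rx≤ry = ≮⇒≥ λ y<x → <⇒≱
    (count-strictMono (_≤? y) (_≤? x) (λ z≤y → ≤-trans z≤y (<⇒≤ y<x)) x∈w ≤-refl (<⇒≱ y<x))
    rx≤ry

-- Sorting

-- Passing to lists removes the length `cast` inside `sorted`, so facts about `sort` apply.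
toList-sorted : (w : Vec ℕ k) → toList (sorted w) ≡ sort (toList w)
toList-sorted w = trans (toList-cast _ (fromList (sort (toList w)))) (toList∘fromList (sort (toList w)))

∈-sorted : ∀ {x} {w : Vec ℕ k} → x Vec.∈ w → x Vec.∈ sorted w
∈-sorted {x = x} {w} x∈w = ∈-toList⁻ (subst (x ∈_) (sym (toList-sorted w))
  (∈-resp-↭ (↭-sym (sort-↭ (toList w))) (∈-toList⁺ x∈w)))

module _ {f : ℕ → ℕ} (f-≤ : ∀ {x y} → f x ≤ f y ⇔ x ≤ y) where

  insert-map : ∀ x xs → insert (f x) (List.map f xs) ≡ List.map f (insert x xs)
  insert-map x List.[]       = refl
  -- Both comparisons have the same truth value, so the two insertions branch alike.
  insert-map x (y List.∷ xs) rewrite does-⇔ f-≤ (f x ≤? f y) (x ≤? y) with does (x ≤? y)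
  ... | true  = refl
  ... | false = cong (f y List.∷_) (insert-map x xs)

  sort-map : ∀ xs → sort (List.map f xs) ≡ List.map f (sort xs)
  sort-map List.[]       = refl
  sort-map (x List.∷ xs) = trans (cong (insert (f x)) (sort-map xs)) (insert-map x (sort xs))

  sorted-map : (w : Vec ℕ k) → sorted (map f w) ≡ map f (sorted w)
  -- `toList-injective` concludes up to a `cast`, here along `refl`.
  sorted-map w = trans (sym (cast-is-id refl _)) (toList-injective refl _ _ (begin
    toList (sorted (map f w))       ≡⟨ toList-sorted (map f w) ⟩
    sort (toList (map f w))         ≡⟨ cong sort (toList-map f w) ⟩
    sort (List.map f (toList w))    ≡⟨ sort-map (toList w) ⟩
    List.map f (sort (toList w))    ≡⟨ cong (List.map f) (toList-sorted w) ⟨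
    List.map f (toList (sorted w))  ≡⟨ toList-map f (sorted w) ⟨
    toList (map f (sorted w))       ∎))
    where open ≡-Reasoning

-- Chains and their gaps

-- The outer bounds are indices, so that an induction along the word can make each letter the next
-- lower bound. Strictness makes the truncated subtractions in `gaps` exact.
data Chain : ℕ → Vec ℕ k → ℕ → Set where
  [_] : a < b → Chain a [] b
  _∷_ : ∀ {c} {cs : Vec ℕ k} → a < c → Chain c cs b → Chain a (c ∷ cs) b

-- spacing n w is definitionally gaps 0 (sorted w) (suc n).
gaps : ℕ → Vec ℕ k → ℕ → Vec ℕ (suc k)
gaps a s b = zipWith (λ c c⁺ → c⁺ ∸ c ∸ 1) (a ∷ s) (s ∷ʳ b)

chain-lower : ∀ {s : Vec ℕ k} {x} → Chain a s b → x Vec.∈ s → a < x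
chain-lower (a<c ∷ _) (here refl) = a<c
chain-lower (a<c ∷ ch) (there x∈cs) = <-trans a<c (chain-lower ch x∈cs)

chain-< : ∀ {s : Vec ℕ k} → Chain a s b → a < b
chain-< [ a<b ]    = a<b
chain-< (a<c ∷ ch) = <-trans a<c (chain-< ch)

chain-map⁻ : ∀ {f} → (∀ {x y} → f x < f y → x < y) → (s : Vec ℕ k) →
             Chain (f a) (map f s) (f b) → Chain a s b
chain-map⁻ f-cancel []      [ a<b ]    = [ f-cancel a<b ]
chain-map⁻ f-cancel (c ∷ s) (a<c ∷ ch) = f-cancel a<c ∷ chain-map⁻ f-cancel s ch

allPairs⇒chain : (s : Vec ℕ k) → a < b → ListAll.All (a <_) (toList s) → ListAll.All (_< b) (toList s) →
                 AllPairs _<_ (toList s) → Chain a s b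
allPairs⇒chain []      a<b _               _               _              = [ a<b ]
allPairs⇒chain (c ∷ s) _   (a<c ∷ _) (c<b ∷ s<b) (c<s ∷ s↗) =
  a<c ∷ allPairs⇒chain s c<b c<s s<b s↗

unique-toList : {w : Vec ℕ k} → Unique w → AllPairs _≢_ (toList w)
unique-toList []       = []
unique-toList (x≢ ∷ u) = ListAll.tabulate (λ y∈ → All.lookup x≢ (∈-toList⁻ y∈)) ∷ unique-toList u

sorted-chain : {w : Vec ℕ k} → IsDistinctWord n w → Chain 0 (sorted w) (suc n)
sorted-chain {n = n} {w = w} dw =
  allPairs⇒chain (sorted w) (s≤s z≤n)
    (ListAll.map proj₁ bounds) (ListAll.map (s≤s ∘ proj₂) bounds) increasing
  where
  open IsDistinctWord dw

  bounds : ListAll.All (λ x → 1 ≤ x × x ≤ n) (toList (sorted w))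
  bounds rewrite toList-sorted w = All-resp-↭ (↭-sym (sort-↭ (toList w)))
    (ListAll.tabulate (λ x∈w → All.lookup inRange (∈-toList⁻ x∈w)))

  increasing : AllPairs _<_ (toList (sorted w))
  -- Sorting alone gives `≤`; distinctness, carried along the permutation, makes it strict.
  increasing rewrite toList-sorted w = AllPairs.zipWith (λ (x≤y , x≢y) → ≤∧≢⇒< x≤y x≢y)
    ( Sorted⇒AllPairs ≤-totalOrder (sort-↗ (toList w))
    , Permutationₛ.Unique-resp-↭ (setoid ℕ) (↭⇒↭ₛ (↭-sym (sort-↭ (toList w)))) (unique-toList distinct))

gap-suc : ∀ a b → suc b ∸ a ∸ 1 ≡ b ∸ a
gap-suc a b = trans (∸-+-assoc (suc b) a 1) (cong (suc b ∸_) (+-comm a 1))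

gap+suc : a < b → (b ∸ a ∸ 1) + suc a ≡ b
gap+suc {a} {suc b} (s≤s a≤b) = begin
  (suc b ∸ a ∸ 1) + suc a  ≡⟨ cong (_+ suc a) (gap-suc a b) ⟩
  (b ∸ a) + suc a          ≡⟨ +-suc (b ∸ a) a ⟩
  suc ((b ∸ a) + a)        ≡⟨ cong suc (m∸n+n≡m a≤b) ⟩
  suc b                    ∎
  where open ≡-Reasoning

-- The `b` numbers below `b` are those inside the gaps, the `k` entries of `s`, and `0, …, a`.
sum-gaps : {s : Vec ℕ k} → Chain a s b → sum (gaps a s b) + (k + suc a) ≡ b
sum-gaps {a = a} {b = b} [ a<b ] = trans (cong (_+ suc a) (+-identityʳ (b ∸ a ∸ 1))) (gap+suc a<b)
sum-gaps {k = suc k} {a = a} {b = b} {s = c ∷ s} (a<c ∷ ch) = begin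
  (d + S) + (suc k + suc a)  ≡⟨ rearrange d S k (suc a) ⟩
  S + (k + suc (d + suc a))  ≡⟨ cong (λ x → S + (k + suc x)) (gap+suc a<c) ⟩
  S + (k + suc c)            ≡⟨ sum-gaps ch ⟩
  b                          ∎
  where
  open ≡-Reasoning
  d = c ∸ a ∸ 1
  S = sum (gaps c s b)

  rearrange : ∀ d S k a → (d + S) + (suc k + a) ≡ S + (k + suc (d + a))
  rearrange = solve-∀

sum-mono : {u v : Vec ℕ k} → Pointwise _≤_ u v → sum u ≤ sum v
sum-mono []          = z≤n
sum-mono (x≤y ∷ u≤v) = +-mono-≤ x≤y (sum-mono u≤v)

-- A strict inequality in any component would make the sums differ.
pointwise-≤-antisym-sum : {u v : Vec ℕ k} → Pointwise _≤_ u v → sum v ≤ sum u → v ≡ u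
pointwise-≤-antisym-sum []          _ = refl
pointwise-≤-antisym-sum {u = x ∷ u} {y ∷ v} (x≤y ∷ u≤v) Σv≤Σu = cong₂ _∷_
  (≤-antisym (+-cancelʳ-≤ (sum u) y x (≤-trans (+-monoʳ-≤ y (sum-mono u≤v)) Σv≤Σu)) x≤y)
  (pointwise-≤-antisym-sum u≤v (+-cancelˡ-≤ x (sum v) (sum u) (≤-trans (+-monoˡ-≤ (sum v) x≤y) Σv≤Σu)))

-- Reinserting a letter

-- The increasing enumeration of the numbers other than t.
shift : ℕ → ℕ → ℕ
shift zero    a       = suc a
shift (suc t) zero    = zero
shift (suc t) (suc a) = suc (shift t a)

-- Links deletion in `Fin`, for positions and values alike, with arithmetic on plain numbers.
toℕ-punchIn : (i : Fin (suc n)) (j : Fin n) → toℕ (punchIn i j) ≡ shift (toℕ i) (toℕ j)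
toℕ-punchIn zero    j       = refl
toℕ-punchIn (suc i) zero    = refl
toℕ-punchIn (suc i) (suc j) = cong suc (toℕ-punchIn i j)

shift-mono-< : ∀ t → a < b → shift t a < shift t b
shift-mono-< zero    a<b = s≤s a<b
shift-mono-< (suc t) (s≤s z≤n) = s≤s z≤n
shift-mono-< (suc t) (s≤s a<b@(s≤s _)) = s≤s (shift-mono-< t a<b)

shift-cancel-< : ∀ t → shift t a < shift t b → a < b
shift-cancel-< {a = a} {b} t lt with <-cmp a b
... | tri< a<b _ _  = a<b
... | tri≈ _ refl _ = contradiction lt (<-irrefl refl)
... | tri> _ _ b<a  = contradiction (shift-mono-< t b<a) (<-asym lt)

shift-≤ : ∀ t → shift t a ≤ shift t b ⇔ a ≤ b
shift-≤ t = mk⇔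
  (λ le → ≮⇒≥ (λ b<a → <⇒≱ (shift-mono-< t b<a) le))
  (λ le → ≮⇒≥ (λ lt → <⇒≱ (shift-cancel-< t lt) le))

shift-below : a < t → shift t a ≡ a
shift-below {zero}  {suc t} _         = refl
shift-below {suc a} {suc t} (s≤s a<t) = cong suc (shift-below a<t)

shift-above : t ≤ a → shift t a ≡ suc a
shift-above {zero}            _         = refl
shift-above {suc t} {suc a} (s≤s t≤a) = cong suc (shift-above t≤a)

-- Numbers from `t` on are sent above `t`, so an image below `t` comes from a fixed number.
shift-below⁻ : a < t → shift t b ≡ a → b ≡ a
shift-below⁻ {t = t} {b} a<t refl with <-≤-connex b t
... | inj₁ b<t = sym (shift-below b<t)
... | inj₂ t≤b = contradiction (subst (_< t) (shift-above t≤b) a<t) (≤⇒≯ (m≤n⇒m≤1+n t≤b))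

shift-above⁻ : t < a → shift t b ≡ a → a ≡ suc b
shift-above⁻ {t} {b = b} t<a refl with <-≤-connex b t
... | inj₁ b<t = contradiction (subst (t <_) (shift-below b<t) t<a) (<-asym b<t)
... | inj₂ t≤b = shift-above t≤b

unshift : ∀ t a → t ≢ a → ∃[ b ] shift t b ≡ a
unshift zero    zero    t≢a = contradiction refl t≢a
unshift zero    (suc a) t≢a = a , refl
unshift (suc t) zero    t≢a = zero , refl
unshift (suc t) (suc a) t≢a with unshift t a (t≢a ∘ cong suc)
... | b , eq = suc b , cong suc eq

unshift-vec : (w : Vec ℕ k) → t Vec.∉ w → ∃[ w′ ] map (shift t) w′ ≡ w
unshift-vec         []      t∉w = [] , refl
unshift-vec {t = t} (a ∷ w) t∉w
  with unshift t a (t∉w ∘ here) | unshift-vec w (t∉w ∘ there)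
... | b , refl | w′ , refl = b ∷ w′ , refl

-- Choosing the letter to delete

gaps-above : ∀ {s s′ : Vec ℕ k} {a′ b′} → Chain a s b → t < a →
             shift t a′ ≡ a → map (shift t) s′ ≡ s → shift t b′ ≡ b →
             gaps a′ s′ b′ ≡ gaps a s b
gaps-above {s = []} {[]} [ a<b ] t<a eqa _ eqb = cong (_∷ [])
  (cong₂ (λ x y → y ∸ x ∸ 1) (sym (shift-above⁻ t<a eqa)) (sym (shift-above⁻ (<-trans t<a a<b) eqb)))
gaps-above {s = _ ∷ _} {c′ ∷ s′} (a<c ∷ ch) t<a eqa refl eqb =
  cong₂ _∷_
    (cong₂ (λ x y → y ∸ x ∸ 1) (sym (shift-above⁻ t<a eqa)) (sym (shift-above⁻ (<-trans t<a a<c) refl)))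
    (gaps-above ch (<-trans t<a a<c) refl refl eqb)

spare-room : ∀ {x} → x < b ∸ a ∸ 1 → suc a < b
spare-room {b} {a} {x} x<gap = ≰⇒> λ b≤1+a → contradiction
  (subst (x <_) (trans (∸-+-assoc b a 1) (m≤n⇒m∸n≡0 (≤-trans b≤1+a (≤-reflexive (+-comm 1 a))))) x<gap)
  n≮0

-- Deleting `suc a` fixes the lower end and lowers the upper end by one; the strict inequality
-- absorbs that loss.
gap-decrease : ∀ {a′ b′ x} → x < b ∸ a ∸ 1 → shift (suc a) a′ ≡ a → shift (suc a) b′ ≡ b →
               x ≤ b′ ∸ a′ ∸ 1
gap-decrease {b = b} {a} {a′} {b′} {x} x<gap eqa eqb
  with shift-below⁻ ≤-refl eqa | shift-above⁻ (spare-room {b} {a} x<gap) eqb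
... | refl | refl = <⇒≤pred (subst (x <_) (gap-suc a b′) x<gap)

-- A surplus in the sum forces one in some component; `t` is the smallest number in the first gap
-- that has one. The last clause ranges over all preimages under `shift t`, since the shortened word
-- is constructed only later.
removable : {s : Vec ℕ k} {v : Vec ℕ (suc k)} → Chain a s b →
            Pointwise _≤_ v (gaps a s b) → sum v < sum (gaps a s b) →
            ∃[ t ] (a < t × t < b × t Vec.∉ s ×
              (∀ {a′ b′ s′} → shift t a′ ≡ a → map (shift t) s′ ≡ s → shift t b′ ≡ b →
                Pointwise _≤_ v (gaps a′ s′ b′)))
removable {a = a} {b} {v = x ∷ []} [ a<b ] (_ ∷ []) Σ< =
  suc a , ≤-refl , spare-room {b} {a} x<gap , (λ ()) ,
  λ { {s′ = []} eqa _ eqb → gap-decrease {b} x<gap eqa eqb ∷ [] }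
  where
  x<gap : x < b ∸ a ∸ 1
  -- The sum of a singleton unfolds to `x + 0`.
  x<gap = +-cancelʳ-< 0 x (b ∸ a ∸ 1) Σ<
removable {a = a} {b} {s = c ∷ s} {v = x ∷ v} (a<c ∷ ch) (x≤gap ∷ v≤gaps) Σ< with m≤n⇒m<n∨m≡n x≤gap
... | inj₁ x<gap =
  suc a , ≤-refl , <-trans 1+a<c (chain-< ch) , 1+a∉ ,
  λ { {s′ = c′ ∷ s′} eqa refl eqb →
        gap-decrease {c} x<gap eqa refl ∷
        -- Later gaps have both ends above the deleted letter, so both drop by one.
        subst (Pointwise _≤_ v) (sym (gaps-above ch 1+a<c refl refl eqb)) v≤gaps }
  where
  1+a<c : suc a < c
  1+a<c = spare-room {c} {a} x<gap

  1+a∉ : suc a Vec.∉ (c ∷ s)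
  1+a∉ (here refl)  = <-irrefl refl 1+a<c
  1+a∉ (there 1+a∈) = <-asym 1+a<c (chain-lower ch 1+a∈)
-- The first gap is exact, so the whole surplus lies in the later ones.
... | inj₂ refl with removable ch v≤gaps (+-cancelˡ-< x _ _ Σ<)
... | t , c<t , t<b , t∉s , rest =
  t , <-trans a<c c<t , t<b , (λ { (here refl) → <-irrefl refl c<t ; (there t∈s) → t∉s t∈s }) ,
  λ { {s′ = c′ ∷ s′} eqa refl eqb →
        -- Both ends lie below `t` and stay fixed.
        ≤-reflexive (cong₂ (λ a c → c ∸ a ∸ 1)
          (sym (shift-below⁻ (<-trans a<c c<t) eqa)) (sym (shift-below⁻ c<t refl))) ∷
        rest refl refl eqb }

-- Copies and the removal of a letter

-- The passage to 1-based letters is harmless because `shift (suc t) (suc a)` is `suc (shift t a)`.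
letter-punchIn : (π : Permutation′ (suc n)) (j : Fin (suc n)) (i : Fin n) →
                 letter π (punchIn j i) ≡ shift (letter π j) (letter (remove j π) i)
letter-punchIn π j i = cong suc (trans (cong toℕ (punchIn-permute π j i)) (toℕ-punchIn (π ⟨$⟩ʳ j) _))

-- `m` bounds every element of `X`, so even the later of the two indices tied together by `x`
-- belongs to the head.
X<headLength : (P : VincularPattern) → let open VincularPattern P in
               ∀ {x} → x Subset.∈ X → suc (toℕ x) < headLength
X<headLength P {x} x∈X = s≤s (ListAll.lookup (xs≤max 0 (List.map (suc ∘ toℕ) (List.filter (_∈? X) (List.allFin _))))
  (∈-map⁺ (suc ∘ toℕ) (∈-filter⁺ (_∈? X) (∈-allFin x) x∈X)))
  where open VincularPattern P

-- Positions and letters both change by increasing maps, which keeps order and pattern. Such maps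
-- can break adjacency, which is why the head must lie before `j`.
copy-remove⁻ : ∀ {P} (π : Permutation′ (suc n)) {j} → k ≤ toℕ j →
               (c : Copy P (remove j π)) → HeadWithin k c → Σ[ c ∈ Copy P π ] HeadWithin k c
copy-remove⁻ {n = n} {k = k} {P = P} π {j} k≤j c hw = record
  { position   = punchIn j ∘ position
  ; increasing = λ {a} {b} a<b → subst₂ _<_
      (sym (toℕ-punchIn j (position a))) (sym (toℕ-punchIn j (position b)))
      (shift-mono-< (toℕ j) (increasing a<b))
  ; reduces    = begin
      red (tabulate (letter π ∘ punchIn j ∘ position))
        ≡⟨ cong red (tabulate-cong (letter-punchIn π j ∘ position)) ⟩
      red (tabulate (shift (letter π j) ∘ letter (remove j π) ∘ position))
        ≡⟨ cong red (tabulate-∘ (shift (letter π j)) (letter (remove j π) ∘ position)) ⟩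
      red (map (shift (letter π j)) (tabulate (letter (remove j π) ∘ position)))
        ≡⟨ red-map _ (tabulate (letter (remove j π) ∘ position)) (λ _ _ → shift-≤ (letter π j)) ⟩
      red (tabulate (letter (remove j π) ∘ position))
        ≡⟨ reduces ⟩
      word σ ∎
  ; adjacent   = λ {x} x∈X → begin
      toℕ (punchIn j (position (suc x)))            ≡⟨ fixed (suc x) (X<headLength P x∈X) ⟩
      toℕ (position (suc x))                        ≡⟨ adjacent x∈X ⟩
      suc (toℕ (position (inject₁ x)))              ≡⟨ cong suc (fixed (inject₁ x) (inject₁<headLength x∈X)) ⟨
      suc (toℕ (punchIn j (position (inject₁ x))))  ∎
  } , λ a a<h → subst (_< k) (sym (fixed a a<h)) (hw a a<h)
  where
  open ≡-Reasoning
  open VincularPattern P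
  open Copy c

  inject₁<headLength : ∀ {x} → x Subset.∈ X → toℕ (inject₁ x) < headLength
  inject₁<headLength {x} x∈X =
    subst (_< headLength) (sym (toℕ-inject₁ x)) (<-trans (n<1+n _) (X<headLength P x∈X))

  -- Head positions are below `k ≤ toℕ j`, where inserting at `j` moves nothing.
  fixed : ∀ a → toℕ a < headLength → toℕ (punchIn j (position a)) ≡ toℕ (position a)
  fixed a a<h = trans (toℕ-punchIn j (position a)) (shift-below (<-≤-trans (hw a a<h) k≤j))

-- Prefixes

-- A position among the first `k` would carry a letter of `w`.
prefix≤ : {w : Vec ℕ k} (π : Permutation′ n) → HasPrefix π w → ∀ j → letter π j Vec.∉ w → k ≤ toℕ j
prefix≤ {w = w} π pre j ∉w = ≮⇒≥ λ j<k →
  let i , i≡j , eq = pre (fromℕ< j<k)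
      i≡j′ = toℕ-injective (trans i≡j (toℕ-fromℕ< j<k))
  in ∉w (subst (Vec._∈ w) (trans (sym eq) (cong (letter π) i≡j′)) (∈-lookup (fromℕ< j<k) w))

-- Deleting a position after the first `k` leaves their indices alone; injectivity of `shift` then
-- recovers the letters of `w`.
prefix-remove : (w : Vec ℕ k) (π : Permutation′ (suc n)) (j : Fin (suc n)) → k ≤ toℕ j →
                HasPrefix π (map (shift (letter π j)) w) → HasPrefix (remove j π) w
prefix-remove w π j k≤j pre i with pre i
... | i₁ , i₁≡i , eq = i₂ , trans (sym toℕ-i₂) i₁≡i , shift-injective (begin
    shift (letter π j) (letter (remove j π) i₂)  ≡⟨ letter-punchIn π j i₂ ⟨
    letter π (punchIn j i₂)                      ≡⟨ cong (letter π) (punchIn-punchOut j≢i₁) ⟩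
    letter π i₁                                  ≡⟨ eq ⟩
    lookup (map (shift (letter π j)) w) i        ≡⟨ lookup-map i _ w ⟩
    shift (letter π j) (lookup w i)              ∎)
  where
  open ≡-Reasoning

  i₁<j : toℕ i₁ < toℕ j
  i₁<j = <-≤-trans (subst (_< _) (sym i₁≡i) (toℕ<n i)) k≤j

  j≢i₁ : j ≢ i₁
  j≢i₁ refl = <-irrefl refl i₁<j

  i₂ = punchOut j≢i₁

  toℕ-i₂ : toℕ i₁ ≡ toℕ i₂
  toℕ-i₂ = sym (shift-below⁻ i₁<j
    (trans (sym (toℕ-punchIn j i₂)) (cong toℕ (punchIn-punchOut j≢i₁))))

  shift-injective : ∀ {x y} → shift (letter π j) x ≡ shift (letter π j) y → x ≡ y
  shift-injective eq = ≤-antisym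
    (Equivalence.to (shift-≤ (letter π j)) (≤-reflexive eq))
    (Equivalence.to (shift-≤ (letter π j)) (≤-reflexive (sym eq)))

-- Bridges the two descriptions of a prefix: `HasPrefix` in `InS`, `take` in `InA`.
take-word : (w : Vec ℕ k) (π : Permutation′ (k + n)) → HasPrefix π w → take k (word π) ≡ w
take-word {k = k} {n = n} w π pre = begin
  take k (word π)                      ≡⟨ tabulate∘lookup _ ⟨
  tabulate (lookup (take k (word π)))  ≡⟨ tabulate-cong agree ⟩
  tabulate (lookup w)                  ≡⟨ tabulate∘lookup w ⟩
  w                                    ∎
  where
  open ≡-Reasoning

  agree : ∀ i → lookup (take k (word π)) i ≡ lookup w i
  agree i with pre i
  ... | j , j≡i , eq = begin
    lookup (take k (word π)) i    ≡⟨ lookup-take-inject≤ (word π) i ⟩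
    lookup (word π) i′            ≡⟨ lookup∘tabulate (letter π) i′ ⟩
    letter π i′                   ≡⟨ cong (letter π) (toℕ-injective (trans (toℕ-inject≤ i _) (sym j≡i))) ⟩
    letter π j                    ≡⟨ eq ⟩
    lookup w i                    ∎
    where i′ = inject≤ i (m≤m+n k n)

-- Induction on the number of surplus letters

1+k+s≡s+[k+1] : ∀ k s → suc (k + s) ≡ s + (k + 1)
1+k+s≡s+[k+1] = solve-∀

HeadCopy : List VincularPattern → ℕ → Permutation′ n → Set
HeadCopy B k π = ∃[ P ] (P ∈ B × Σ[ c ∈ Copy P π ] HeadWithin k c)

module _ (B : List VincularPattern) (k : ℕ) (p : Permutation′ k) (v : Vec ℕ (suc k))
         (A⇒headCopy : ∀ π → InA p v π → HeadCopy B k π) where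

  -- The induction carries a `Chain` because `chain-map⁻` passes it to the shortened word, and
  -- yields a `HeadCopy` because an arbitrary copy might not survive reinsertion.
  large-gaps⇒headCopy : ∀ d (w : Vec ℕ k) (π : Permutation′ (d + (k + sum v))) → HasPrefix π w →
    Chain 0 (sorted w) (suc (d + (k + sum v))) → red w ≡ word p →
    Pointwise _≤_ v (spacing (d + (k + sum v)) w) → HeadCopy B k π
  large-gaps⇒headCopy zero w π pre ch red≡ v≤ = A⇒headCopy π record
    { prefix∼  = begin
        red (take k (word π))  ≡⟨ cong red (take-word w π pre) ⟩
        red w                  ≡⟨ red-idem w ⟨
        red (red w)            ≡⟨ cong red red≡ ⟩
        red (word p)           ∎
    -- Without surplus letters the gaps and `v` have equal sums, so no component of the inequality
    -- is strict.
    ; spacing≡ = trans (cong (spacing (k + sum v)) (take-word w π pre))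
        (pointwise-≤-antisym-sum v≤ (≤-reflexive (+-cancelʳ-≡ (k + 1) _ _
          (trans (sum-gaps ch) (1+k+s≡s+[k+1] k (sum v))))))
    }
    where
    open ≡-Reasoning
  large-gaps⇒headCopy (suc d) w π pre ch red≡ v≤
    -- By `sum-gaps`, the gaps exceed `v` by `suc d` in total.
    with removable ch v≤ (+-cancelʳ-< (k + 1) _ _ (subst (sum v + (k + 1) <_) (sym (sum-gaps ch))
           (s≤s (≤-trans (≤-reflexive (sym (1+k+s≡s+[k+1] k (sum v)))) (s≤s (m≤n+m (k + sum v) d))))))
  -- Lying strictly between the bounds `0` and `n + 1` makes `suc t` a letter of `π`, with 0-based
  -- value `t`.
  ... | suc t , 0<t , s≤s t<n , t∉ , v≤′ = result
    where
    j : Fin (suc (d + (k + sum v)))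
    j = π ⟨$⟩ˡ fromℕ< t<n

    letter-j : letter π j ≡ suc t
    letter-j = cong suc (trans (cong toℕ (inverseʳ π)) (toℕ-fromℕ< t<n))

    t∉w : suc t Vec.∉ w
    t∉w = t∉ ∘ ∈-sorted

    k≤j : k ≤ toℕ j
    k≤j = prefix≤ π pre j (subst (Vec._∉ w) (sym letter-j) t∉w)

    result : HeadCopy B k π
    result with unshift-vec w t∉w
    ... | w′ , refl =
      let sorted≡ = sorted-map (shift-≤ (suc t)) w′
          -- The shift sends the upper bound of the shorter permutation to that of `π`; the lower
          -- bound `0` is fixed by computation.
          top     = cong suc (shift-above (s≤s⁻¹ t<n))
          P , P∈B , c , hw = large-gaps⇒headCopy d w′ (remove j π)
            (prefix-remove w′ π j k≤j (subst (λ x → HasPrefix π (map (shift x) w′)) (sym letter-j) pre))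
            (chain-map⁻ (shift-cancel-< (suc t)) (sorted w′)
              (subst₂ (Chain 0) sorted≡ (sym top) ch))
            (trans (sym (red-map _ w′ (λ _ _ → shift-≤ (suc t)))) red≡)
            (v≤′ refl (sym sorted≡) top)
          c′ , hw′ = copy-remove⁻ π k≤j c hw
      in P , P∈B , c′ , hw′

mainTheorem1 : (B : List VincularPattern) (k : ℕ) (p : Permutation′ k) (v : Vec ℕ (suc k)) →
    (∀ (π : Permutation′ (k + sum v)) → InA p v π →
    ∃[ P ] (P ∈ B × Σ[ c ∈ Copy P π ] HeadWithin k c)) →
    IsGapVector B p v
mainTheorem1 B k p v A⇒headCopy n w dw red≡ v≤ π inS =
  go (n ∸ (k + sum v)) (sym (m∸n+n≡m k+Σv≤n)) dw v≤ π inS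
  where
  -- Ensures that the surplus `n ∸ (k + sum v)` is not truncated.
  k+Σv≤n : k + sum v ≤ n
  k+Σv≤n = s≤s⁻¹ (subst (suc (k + sum v) ≤_) (sum-gaps (sorted-chain dw))
    (≤-trans (≤-reflexive (1+k+s≡s+[k+1] k (sum v))) (+-monoˡ-≤ (k + 1) (sum-mono v≤))))
  -- Generalising over `n` lets the equation be matched with `refl`, giving `π` the length that the
  -- induction expects.
  go : ∀ {n} d → n ≡ d + (k + sum v) → IsDistinctWord n w → Pointwise _≤_ v (spacing n w) →
       (π : Permutation′ n) → ¬ InS B w π
  go d refl dw v≤ π inS =
    let P , P∈B , c , _ = large-gaps⇒headCopy B k p v A⇒headCopy d w π prefix (sorted-chain dw) red≡ v≤
    in avoids P∈B c
    where open InS inS
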